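{- Let $A_1=\{2\text{ - }13,21\text{ - }3\}$, $A_2=\{2\text{ - }31,23\text{ - }1\}$, $A_3=\{1\text{ - }32,13\text{ - }2\}$, $A_4=\{3\text{ - }12,31\text{ - }2\}$. For every choice of $p_i\in A_i$ ($i=1,2,3,4$), if a permutation $\pi\in S_n(p_1,p_2,p_3,p_4)$ also avoids the pattern $1\text{ - }23$, then $\pi=n\,(n-1)\ldots 2\,1$, and $|S_n(p_1,p_2,p_3,p_4,1\text{ - }23)|=1$; that is, the permutations avoiding the five patterns $p_1,p_2,p_3,p_4,1\text{ - }23$ are enumerated according to their length by the sequence $\{1\}_{n\ge1}$.
   Context: $S_n$ is the set of permutations $\pi=\pi_1\pi_2\cdots\pi_n$ of $\{1,\dots,n\}$ (written in one-line notation). For $abc$ a permutation of $123$, the generalized pattern $a\text{ - }bc$ is contained in $\pi$ if there are indices $i<j$ with $j+1\le n$ such that $\pi_i\pi_j\pi_{j+1}$ is order-isomorphic to $abc$; the generalized pattern $ab\text{ - }c$ is contained in $\pi$ if there are indices $i,k$ with $i+1<k\le n$ such that $\pi_i\pi_{i+1}\pi_k$ is order-isomorphic to $abc$. $\pi$ avoids a pattern if it does not contain it. $S_n(p_1,\dots,p_m)$ is the set of $\pi\in S_n$ avoiding all of $p_1,\dots,p_m$. The sequence $\{1\}_{n\ge1}$ is the constant sequence whose term is $1$ for every length $n\ge1$.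
   Formalization: Length n = 2 is excluded: there both 12 and 21 avoid all patterns of length three, so the count is 2 and the claim fails; all other lengths n ≥ 1 are covered. -}

module Defs where

open import Data.Fin.Base using (Fin; toℕ)
open import Data.Fin.Permutation using (Permutation′; _⟨$⟩ʳ_)
open import Data.List.Base using (List; []; _∷_)
open import Data.List.Membership.DecPropositional using (_∈?_)
open import Data.List.Relation.Unary.All using (All; all?)
open import Data.Nat.Base using (ℕ; suc; _<_)
open import Data.Nat.Properties using (_≟_)
open import Data.Product.Base using (Σ; ∃-syntax; _×_; proj₁)
open import Data.Vec.Base using (Vec; []; _∷_; lookup)
open import Function.Base using (_∘_)
open import Function.Bundles using (Inverse; _⇔_)
open import Level using (Level; 0ℓ; _⊔_)
open import Relation.Binary.Bundles using (Setoid)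
open import Relation.Binary.PropositionalEquality using (_≡_; setoid; _→-setoid_)
import Relation.Binary.Construct.On as On
open import Relation.Nullary.Decidable using (True)
open import Relation.Nullary.Negation using (¬_)

-- Three letters containing each of 1, 2, 3, hence a permutation of 123;
-- decided, so that concrete patterns need no explicit proof.
IsPermutationOf123 : ℕ → ℕ → ℕ → Set
IsPermutationOf123 a b c =
  True (all? (λ x → _∈?_ _≟_ x (a ∷ b ∷ c ∷ [])) (1 ∷ 2 ∷ 3 ∷ []))

-- `a - b ∙ c` is the pattern a-bc and `a ∙ b - c` is ab-c: letters joined
-- by ∙ must be matched by adjacent entries.
data GenPattern : Set where
  _-_∙_ : (a b c : ℕ) {perm : IsPermutationOf123 a b c} → GenPattern
  _∙_-_ : (a b c : ℕ) {perm : IsPermutationOf123 a b c} → GenPattern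

OrderIsomorphic : {k : ℕ} → Vec ℕ k → Vec ℕ k → Set
OrderIsomorphic u v =
  ∀ s t → (lookup u s < lookup u t) ⇔ (lookup v s < lookup v t)

-- Positions are 0-based (Fin n), entries are 1-based (in {1,…,n}).
entry : {n : ℕ} → Permutation′ n → Fin n → ℕ
entry π i = suc (toℕ (π ⟨$⟩ʳ i))

Contains : {n : ℕ} → Permutation′ n → GenPattern → Set
Contains π (a - b ∙ c) = ∃[ i ] ∃[ j ] ∃[ k ]
  toℕ i < toℕ j × toℕ k ≡ suc (toℕ j) ×
  OrderIsomorphic (entry π i ∷ entry π j ∷ entry π k ∷ []) (a ∷ b ∷ c ∷ [])
Contains π (a ∙ b - c) = ∃[ i ] ∃[ j ] ∃[ k ]
  toℕ j ≡ suc (toℕ i) × toℕ j < toℕ k ×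
  OrderIsomorphic (entry π i ∷ entry π j ∷ entry π k ∷ []) (a ∷ b ∷ c ∷ [])

Avoids : {n : ℕ} → Permutation′ n → GenPattern → Set
Avoids π p = ¬ Contains π p

AvoidsAll : {n : ℕ} → List GenPattern → Permutation′ n → Set
AvoidsAll ps π = All (Avoids π) ps

-- Elements are identified when the underlying functions agree pointwise:
-- without function extensionality, propositional equality of bijections
-- (or of avoidance proofs) would distinguish the same permutation.
S : (n : ℕ) → List GenPattern → Setoid 0ℓ 0ℓ
S n ps = On.setoid (Fin n →-setoid Fin n) f
  where
  f : Σ (Permutation′ n) (AvoidsAll ps) → Fin n → Fin n
  f = _⟨$⟩ʳ_ ∘ proj₁

∣_∣≡_ : {a ℓ : Level} → Setoid a ℓ → ℕ → Set (a ⊔ ℓ)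
∣ X ∣≡ k = Inverse X (setoid (Fin k))

A₁ A₂ A₃ A₄ : List GenPattern
A₁ = (2 - 1 ∙ 3) ∷ (2 ∙ 1 - 3) ∷ []
A₂ = (2 - 3 ∙ 1) ∷ (2 ∙ 3 - 1) ∷ []
A₃ = (1 - 3 ∙ 2) ∷ (1 ∙ 3 - 2) ∷ []
A₄ = (3 - 1 ∙ 2) ∷ (3 ∙ 1 - 2) ∷ []

{-# OPTIONS --safe #-}

-- Three consecutive entries of π that are order-isomorphic to abc are an
-- occurrence of both a-bc and ab-c.  Hence avoiding the five patterns, whatever
-- the choice of the pᵢ, forces every three consecutive entries to be decreasing,
-- and for n ≥ 3 any two adjacent entries lie in such a triple.

module Submission where

open import Defs
open import Data.Fin.Base as Fin using (Fin; zero; suc; toℕ; fromℕ<; inject₁)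
open import Data.Fin.Patterns using (0F; 1F; 2F)
open import Data.Fin.Permutation using (Permutation′; _≈_; reverse; _⟨$⟩ʳ_)
open import Data.Fin.Properties as Fin
  using (toℕ-fromℕ<; toℕ-inject₁; toℕ-injective; toℕ<n; opposite-prop)
open import Data.List.Base using ([]; _∷_)
open import Data.List.Membership.Propositional using (_∈_)
open import Data.List.Relation.Unary.All as All using (All; []; _∷_)
open import Data.Nat.Base using (ℕ; zero; suc; _+_; _∸_; _≤_; _<_; z≤n; s≤s)
open import Data.Nat.Properties
open import Data.Product.Base using (∃-syntax; _×_; _,_; proj₁; proj₂)
open import Data.Vec.Base using (Vec; []; _∷_; lookup; map)
open import Data.Vec.Properties using (lookup-map)
open import Function.Base using (_∘_)
open import Function.Bundles using (Injection; Equivalence; mk⇔)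
open import Function.Properties.Inverse using (Inverse⇒Injection)
open import Relation.Binary.Definitions using (tri<; tri≈; tri>)
open import Relation.Binary.PropositionalEquality
  using (_≡_; _≢_; refl; sym; trans; cong; subst)
open import Relation.Nullary.Decidable using (yes; no)
open import Relation.Nullary.Negation using (¬_; contradiction)

private variable
  n k : ℕ

letters : GenPattern → Vec ℕ 3
letters (a - b ∙ c) = a ∷ b ∷ c ∷ []
letters (a ∙ b - c) = a ∷ b ∷ c ∷ []

entries : Permutation′ n → (i j k : Fin n) → Vec ℕ 3
entries π i j k = entry π i ∷ entry π j ∷ entry π k ∷ []

Adjacent : Fin n → Fin n → Set
Adjacent i j = toℕ j ≡ suc (toℕ i)

Adjacent⇒< : (i j : Fin n) → Adjacent i j → toℕ i < toℕ j
Adjacent⇒< _ _ eq = ≤-reflexive (sym eq)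

consecutive⇒Contains : (π : Permutation′ n) (p : GenPattern) {i j k : Fin n} →
  Adjacent i j → Adjacent j k →
  OrderIsomorphic (entries π i j k) (letters p) → Contains π p
consecutive⇒Contains π (a - b ∙ c) {i} {j} ij jk iso = _ , _ , _ , Adjacent⇒< i j ij , jk , iso
consecutive⇒Contains π (a ∙ b - c) {_} {j} {k} ij jk iso = _ , _ , _ , ij , Adjacent⇒< j k jk , iso

-- Weakening adjacency to `<` on positions gives an occurrence of the classical pattern. This is
-- enough to rule out both kinds of pattern in a decreasing permutation.
Contains⇒occurrence : (π : Permutation′ n) (p : GenPattern) → Contains π p →
  ∃[ i ] ∃[ j ] ∃[ k ] i Fin.< j × j Fin.< k ×
  OrderIsomorphic (entries π i j k) (letters p)
Contains⇒occurrence π (a - b ∙ c) (i , j , k , i<j , jk , iso) =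
  i , j , k , i<j , Adjacent⇒< j k jk , iso
Contains⇒occurrence π (a ∙ b - c) (i , j , k , ij , j<k , iso) =
  i , j , k , Adjacent⇒< i j ij , j<k , iso

-- The two members of each `Aᵢ` differ only in the place of the dash, which `letters` forgets. All
-- sixteen choices of the `pᵢ` are thus treated at once.
letters-A₁ : All (λ p → letters p ≡ 2 ∷ 1 ∷ 3 ∷ []) A₁
letters-A₁ = refl ∷ refl ∷ []

letters-A₂ : All (λ p → letters p ≡ 2 ∷ 3 ∷ 1 ∷ []) A₂
letters-A₂ = refl ∷ refl ∷ []

letters-A₃ : All (λ p → letters p ≡ 1 ∷ 3 ∷ 2 ∷ []) A₃
letters-A₃ = refl ∷ refl ∷ []

letters-A₄ : All (λ p → letters p ≡ 3 ∷ 1 ∷ 2 ∷ []) A₄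
letters-A₄ = refl ∷ refl ∷ []

StrictlyMonotone : (Fin k → ℕ) → Set
StrictlyMonotone f = ∀ {p q} → p Fin.< q → f p < f q

StrictlyMonotone⇒reflects-< : (f : Fin k → ℕ) → StrictlyMonotone f →
  ∀ p q → f p < f q → p Fin.< q
StrictlyMonotone⇒reflects-< f mono p q fp<fq with Fin.<-cmp p q
... | tri< p<q _ _    = p<q
... | tri≈ _ refl _   = contradiction fp<fq (<-irrefl refl)
... | tri> _ _ q<p    = contradiction fp<fq (<-asym (mono q<p))

-- `Fin k` is totally ordered, so a strictly monotone map also reflects `<`. Comparisons in either
-- vector therefore amount to comparisons in `σ`.
map-orderIsomorphic : (f g : Fin k → ℕ) → StrictlyMonotone f → StrictlyMonotone g →
  ∀ {m} (σ : Vec (Fin k) m) → OrderIsomorphic (map f σ) (map g σ)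
map-orderIsomorphic f g f-mono g-mono σ s t
  rewrite lookup-map s f σ | lookup-map t f σ | lookup-map s g σ | lookup-map t g σ =
  mk⇔ (λ lt → g-mono (StrictlyMonotone⇒reflects-< f f-mono _ _ lt))
      (λ lt → f-mono (StrictlyMonotone⇒reflects-< g g-mono _ _ lt))

sorted-strictlyMonotone : ∀ {l m h} → l < m → m < h →
  StrictlyMonotone (lookup (l ∷ m ∷ h ∷ []))
sorted-strictlyMonotone l<m m<h {0F} {1F} _ = l<m
sorted-strictlyMonotone l<m m<h {0F} {2F} _ = <-trans l<m m<h
sorted-strictlyMonotone l<m m<h {1F} {2F} _ = m<h
sorted-strictlyMonotone l<m m<h {1F} {1F} (s≤s ())
sorted-strictlyMonotone l<m m<h {2F} {1F} (s≤s ())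
sorted-strictlyMonotone l<m m<h {2F} {2F} (s≤s (s≤s ()))

-- Here `σ` is the pattern with letters counted from 0: one map turns them into the sorted values,
-- the other into the usual letters.
pattern-orderIsomorphic : ∀ {l m h} → l < m → m < h → (σ : Vec (Fin 3) 3) →
  OrderIsomorphic (map (lookup (l ∷ m ∷ h ∷ [])) σ) (map (suc ∘ toℕ) σ)
pattern-orderIsomorphic l<m m<h =
  map-orderIsomorphic _ _ (sorted-strictlyMonotone l<m m<h) s≤s

only-321-remains : ∀ {x y z} → x ≢ y → y ≢ z → x ≢ z →
  let w = x ∷ y ∷ z ∷ [] in
  ¬ OrderIsomorphic w (2 ∷ 1 ∷ 3 ∷ []) →
  ¬ OrderIsomorphic w (2 ∷ 3 ∷ 1 ∷ []) →
  ¬ OrderIsomorphic w (1 ∷ 3 ∷ 2 ∷ []) →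
  ¬ OrderIsomorphic w (3 ∷ 1 ∷ 2 ∷ []) →
  ¬ OrderIsomorphic w (1 ∷ 2 ∷ 3 ∷ []) →
  y < x × z < y
only-321-remains {x} {y} {z} x≢y y≢z x≢z ¬213 ¬231 ¬132 ¬312 ¬123
  with <-cmp x y | <-cmp y z | <-cmp x z
... | tri≈ _ x≡y _ | _            | _            = contradiction x≡y x≢y
... | _            | tri≈ _ y≡z _ | _            = contradiction y≡z y≢z
... | _            | _            | tri≈ _ x≡z _ = contradiction x≡z x≢z
... | tri> _ _ y<x | tri> _ _ z<y | _            = y<x , z<y
-- In each remaining case the vector lists the 0-based ranks of `x`, `y`, `z`, so that mapping the
-- sorted values along it computes to `x ∷ y ∷ z ∷ []`.
... | tri< x<y _ _ | tri< y<z _ _ | _            =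
  contradiction (pattern-orderIsomorphic x<y y<z (0F ∷ 1F ∷ 2F ∷ [])) ¬123
... | tri< x<y _ _ | tri> _ _ z<y | tri< x<z _ _ =
  contradiction (pattern-orderIsomorphic x<z z<y (0F ∷ 2F ∷ 1F ∷ [])) ¬132
... | tri< x<y _ _ | tri> _ _ z<y | tri> _ _ z<x =
  contradiction (pattern-orderIsomorphic z<x x<y (1F ∷ 2F ∷ 0F ∷ [])) ¬231
... | tri> _ _ y<x | tri< y<z _ _ | tri< x<z _ _ =
  contradiction (pattern-orderIsomorphic y<x x<z (1F ∷ 0F ∷ 2F ∷ [])) ¬213
... | tri> _ _ y<x | tri< y<z _ _ | tri> _ _ z<x =
  contradiction (pattern-orderIsomorphic y<z z<x (2F ∷ 0F ∷ 1F ∷ [])) ¬312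

entry-injective : (π : Permutation′ n) {i j : Fin n} → entry π i ≡ entry π j → i ≡ j
entry-injective π eq =
  Injection.injective (Inverse⇒Injection π) (toℕ-injective (suc-injective eq))

DescendsAt : Permutation′ n → Fin n → Fin n → Set
DescendsAt π i j = entry π j < entry π i

Descending : Permutation′ n → Set
Descending π = ∀ {i j} → Adjacent i j → DescendsAt π i j

-- If `j` is not the last position, the triple starts at `i`; otherwise it ends at `j` and starts
-- just before `i`. Both fail only if `i` is first and `j` last, which forces `n` below 3.
consecutiveTriples⇒Descending : (π : Permutation′ n) → 3 ≤ n →
  (∀ {i j k} → Adjacent i j → Adjacent j k → DescendsAt π i j × DescendsAt π j k) →
  Descending π
consecutiveTriples⇒Descending {n} π 3≤n triple {i} {j} ij with suc (toℕ j) <? n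
... | yes j+1<n = proj₁ (triple ij (toℕ-fromℕ< j+1<n))
consecutiveTriples⇒Descending π 3≤n triple {zero} {j} ij | no j+1≮n =
  contradiction (subst (λ m → suc m < _) (sym ij) 3≤n) j+1≮n
consecutiveTriples⇒Descending π 3≤n triple {suc i} {j} ij | no _ =
  proj₂ (triple {inject₁ i} (cong suc (sym (toℕ-inject₁ i))) ij)

-- The first entry is at most `n`, and each step to the right loses at least 1. The recursion runs
-- on `m` because `inject₁ i` is not structurally smaller than `suc i`.
Descending⇒upper : (π : Permutation′ n) → Descending π →
  ∀ m i → m ≡ toℕ i → entry π i + m ≤ n
Descending⇒upper π desc zero i _ =
  ≤-trans (≤-reflexive (+-identityʳ _)) (toℕ<n (π ⟨$⟩ʳ i))
Descending⇒upper π desc (suc m) (suc i) eq =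
  ≤-trans (≤-reflexive (+-suc _ m))
    (≤-trans (+-monoˡ-≤ m (desc (cong suc (sym (toℕ-inject₁ i)))))
      (Descending⇒upper π desc m (inject₁ i)
        (trans (suc-injective eq) (sym (toℕ-inject₁ i)))))

-- Here `m` counts the positions to the right of `i`: the last entry is at least 1, and each step to
-- the left gains at least 1.
Descending⇒lower : (π : Permutation′ n) → Descending π →
  ∀ m i → m + suc (toℕ i) ≡ n → suc m ≤ entry π i
Descending⇒lower π desc zero i _ = s≤s z≤n
Descending⇒lower {n} π desc (suc m) i eq =
  ≤-trans (s≤s (Descending⇒lower π desc m (fromℕ< i+1<n) eq′)) (desc (toℕ-fromℕ< i+1<n))
  where
  i+1<n : suc (toℕ i) < n
  i+1<n = subst (suc (toℕ i) <_) eq (s≤s (m≤n+m _ m))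
  eq′ : m + suc (toℕ (fromℕ< i+1<n)) ≡ n
  eq′ = trans (cong (λ t → m + suc t) (toℕ-fromℕ< i+1<n)) (trans (+-suc m _) eq)

Descending⇒≈reverse : (π : Permutation′ n) → Descending π → π ≈ reverse
Descending⇒≈reverse {n} π desc i =
  -- The two bounds meet at `n ∸ suc (toℕ i)`, the 0-based value of `reverse` at `i`.
  toℕ-injective (trans (≤-antisym upper lower) (sym (opposite-prop i)))
  where
  upper : toℕ (π ⟨$⟩ʳ i) ≤ n ∸ suc (toℕ i)
  upper = m+n≤o⇒m≤o∸n _
    (≤-trans (≤-reflexive (+-suc _ (toℕ i))) (Descending⇒upper π desc (toℕ i) i refl))
  lower : n ∸ suc (toℕ i) ≤ toℕ (π ⟨$⟩ʳ i)
  lower = ≤-pred (Descending⇒lower π desc _ i (m∸n+n≡m (toℕ<n i)))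

reverse-antitone : {i j : Fin n} → i Fin.< j → DescendsAt reverse i j
reverse-antitone {n} {i} {j} i<j
  rewrite opposite-prop i | opposite-prop j = s≤s (∸-monoʳ-< (s≤s i<j) (toℕ<n j))

HasAscent : Vec ℕ k → Set
HasAscent v = ∃[ s ] ∃[ t ] s Fin.< t × lookup v s < lookup v t

reverse-no-ascent : {i j k : Fin n} → i Fin.< j → j Fin.< k →
  ¬ HasAscent (entries reverse i j k)
reverse-no-ascent i<j j<k (0F , 1F , _ , lt) = <-asym lt (reverse-antitone i<j)
reverse-no-ascent i<j j<k (0F , 2F , _ , lt) = <-asym lt (reverse-antitone (<-trans i<j j<k))
reverse-no-ascent i<j j<k (1F , 2F , _ , lt) = <-asym lt (reverse-antitone j<k)
reverse-no-ascent i<j j<k (1F , 1F , s≤s () , _)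
reverse-no-ascent i<j j<k (2F , 1F , s≤s () , _)
reverse-no-ascent i<j j<k (2F , 2F , s≤s (s≤s ()) , _)

-- Order isomorphism would carry the ascent of the letters over to entries of a decreasing
-- permutation.
reverse-avoids : (p : GenPattern) → HasAscent (letters p) → Avoids (reverse {n}) p
reverse-avoids p (s , t , s<t , asc) c with Contains⇒occurrence reverse p c
... | i , j , k , i<j , j<k , iso =
  reverse-no-ascent i<j j<k (s , t , s<t , Equivalence.from (iso s t) asc)

mainTheorem12 : (n : ℕ) → 1 ≤ n → n ≢ 2 →
    (p₁ p₂ p₃ p₄ : GenPattern) → p₁ ∈ A₁ → p₂ ∈ A₂ → p₃ ∈ A₃ → p₄ ∈ A₄ →
    ((π : Permutation′ n) → AvoidsAll (p₁ ∷ p₂ ∷ p₃ ∷ p₄ ∷ []) π →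
    Avoids π (1 - 2 ∙ 3) → π ≈ reverse)
    × (∣ S n (p₁ ∷ p₂ ∷ p₃ ∷ p₄ ∷ (1 - 2 ∙ 3) ∷ []) ∣≡ 1)
mainTheorem12 n 1≤n n≢2 p₁ p₂ p₃ p₄ p₁∈ p₂∈ p₃∈ p₄∈ = unique n 1≤n n≢2 , record
  { to        = λ _ → zero
  ; from      = λ _ → reverse , reverse-avoids-all
  ; to-cong   = λ _ → refl
  ; from-cong = λ _ _ → refl
  ; inverse   = (λ { {zero} _ → refl })
              -- Equality in `S` is pointwise agreement, so uniqueness is exactly what this inverse
              -- law asks for.
              , λ { {π , a₁ ∷ a₂ ∷ a₃ ∷ a₄ ∷ a₅ ∷ []} _ i →
                  sym (unique n 1≤n n≢2 π (a₁ ∷ a₂ ∷ a₃ ∷ a₄ ∷ []) a₅ i) }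
  }
  where
  l₁ : letters p₁ ≡ 2 ∷ 1 ∷ 3 ∷ []
  l₁ = All.lookup letters-A₁ p₁∈
  l₂ : letters p₂ ≡ 2 ∷ 3 ∷ 1 ∷ []
  l₂ = All.lookup letters-A₂ p₂∈
  l₃ : letters p₃ ≡ 1 ∷ 3 ∷ 2 ∷ []
  l₃ = All.lookup letters-A₃ p₃∈
  l₄ : letters p₄ ≡ 3 ∷ 1 ∷ 2 ∷ []
  l₄ = All.lookup letters-A₄ p₄∈

  reverse-avoids-all : AvoidsAll (p₁ ∷ p₂ ∷ p₃ ∷ p₄ ∷ (1 - 2 ∙ 3) ∷ []) (reverse {n})
  reverse-avoids-all =
      -- Each witness is a pair of positions whose letters are consecutive numbers, so `≤-refl`
      -- proves the ascent.
      reverse-avoids p₁ (subst HasAscent (sym l₁) (0F , 2F , s≤s z≤n , ≤-refl))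
    ∷ reverse-avoids p₂ (subst HasAscent (sym l₂) (0F , 1F , s≤s z≤n , ≤-refl))
    ∷ reverse-avoids p₃ (subst HasAscent (sym l₃) (0F , 2F , s≤s z≤n , ≤-refl))
    ∷ reverse-avoids p₄ (subst HasAscent (sym l₄) (1F , 2F , ≤-refl , ≤-refl))
    ∷ reverse-avoids (1 - 2 ∙ 3) (0F , 1F , s≤s z≤n , ≤-refl)
    ∷ []

  triple-descends : ∀ {n} (π : Permutation′ n) →
    AvoidsAll (p₁ ∷ p₂ ∷ p₃ ∷ p₄ ∷ []) π → Avoids π (1 - 2 ∙ 3) →
    ∀ {i j k} → Adjacent i j → Adjacent j k → DescendsAt π i j × DescendsAt π j k
  triple-descends π (a₁ ∷ a₂ ∷ a₃ ∷ a₄ ∷ []) a₅ {i} {j} {k} ij jk = only-321-remains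
    (distinct i<j) (distinct j<k) (distinct (<-trans i<j j<k))
    (excluded p₁ a₁ l₁) (excluded p₂ a₂ l₂) (excluded p₃ a₃ l₃) (excluded p₄ a₄ l₄)
    (excluded (1 - 2 ∙ 3) a₅ refl)
    where
    i<j : i Fin.< j
    i<j = Adjacent⇒< i j ij
    j<k : j Fin.< k
    j<k = Adjacent⇒< j k jk
    distinct : ∀ {s t} → s Fin.< t → entry π s ≢ entry π t
    distinct s<t eq = Fin.<⇒≢ s<t (entry-injective π eq)
    excluded : ∀ {v} (p : GenPattern) → Avoids π p → letters p ≡ v →
      ¬ OrderIsomorphic (entries π i j k) v
    excluded p avoids-p refl iso = avoids-p (consecutive⇒Contains π p ij jk iso)

  unique : ∀ n → 1 ≤ n → n ≢ 2 → (π : Permutation′ n) →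
    AvoidsAll (p₁ ∷ p₂ ∷ p₃ ∷ p₄ ∷ []) π → Avoids π (1 - 2 ∙ 3) → π ≈ reverse
  unique 1 _ _ π _ _ = Descending⇒≈reverse π λ { {zero} {zero} () }
  -- In length 2 no pattern of three letters occurs, so 12 avoids all five as well as 21, and
  -- uniqueness fails.
  unique 2 _ n≢2 = contradiction refl n≢2
  unique (suc (suc (suc n))) _ _ π avoids avoids-1-23 =
    Descending⇒≈reverse π (consecutiveTriples⇒Descending π (s≤s (s≤s (s≤s z≤n)))
      (triple-descends π avoids avoids-1-23))
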